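{- Let $i,j,k\ge 0$ be integers and let $D_{18}=\max\left\{\max\{i,j,k\},\left\lceil\frac{i+j+k}{2}\right\rceil\right\}$. Suppose that $D_{18}=\max\{i,j,k\}=i$. Then the number $f_{18N}(i,j,k)$ of shortest paths from $q=(0,0,0)$ to $p=(i,j,k)$ in the 18-neighborhood of the cubic grid $\mathbb{Z}^3$ is $$f_{18N}(i,j,k)=\sum_{\substack{a\ge 0,\ b\ge 0\\ 2(a+b)\le i-j-k}}\frac{i!}{a!\,b!\,(k+a)!\,(j+b)!\,(i-j-k-2(a+b))!},$$ where the sum is over integers $a,b$.
   Context: The cubic grid is $\mathbb{Z}^3$. For $r=(x_r,y_r,z_r)\in\mathbb{Z}^3$, its 18-neighborhood $N_{18}(r)$ is the set of points $s=(x_s,y_s,z_s)\in\mathbb{Z}^3$ with $\max\{|x_r-x_s|,|y_r-y_s|,|z_r-z_s|\}\le 1$ and $|x_r-x_s|+|y_r-y_s|+|z_r-z_s|\le 2$. A path of length $n$ from $q$ to $p$ in the 18-neighborhood is a sequence of points $q=r_0,r_1,\dots,r_n=p$ of $\mathbb{Z}^3$ with $r_{t+1}\in N_{18}(r_t)$ for $0\le t<n$. A shortest path is a path of minimal length among all paths from $q$ to $p$ in the given neighborhood; two paths are distinct if they differ as sequences of points. The quantity $D_{18}$ is the length of a shortest path from $(0,0,0)$ to $(i,j,k)$ in the 18-neighborhood. In the sum, the index $a$ stands for the number of steps in the direction $(1,0,-1)$ (right-away) and $b$ for the number of steps in the direction $(1,-1,0)$ (right-bottom). -}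

module Defs where

open import Data.Fin.Base using (Fin; zero; suc; inject₁; fromℕ)
open import Data.Integer.Base as ℤ using (ℤ; ∣_∣)
open import Data.List.Base using (List; map; filter; upTo; cartesianProduct)
open import Data.Nat.Base
  using (ℕ; suc; NonZero; _+_; _*_; _∸_; _⊔_; _≤_; _/_; _!; ⌈_/2⌉)
open import Data.Nat.Combinatorics using (k![n∸k]!∣n!)
open import Data.Nat.Divisibility using (_∣_; ∣-trans; *-monoˡ-∣)
open import Data.Nat.ListAction using (sum)
open import Data.Nat.Properties using (_≤?_; _!≢0; m*n≢0; m≤m+n; m+n∸m≡n; m+[n∸m]≡n; ∸-+-assoc)
open import Data.Nat.Solver using (module +-*-Solver)
open import Data.Product.Base using (_×_; _,_)
open import Data.Vec.Base using (Vec; lookup; toList)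
open import Function.Bundles using (Bijection)
open import Level using (0ℓ)
open import Relation.Binary.Bundles using (Setoid)
import Relation.Binary.Construct.On as On
open import Relation.Binary.PropositionalEquality
  using (_≡_; refl; trans; cong; subst; setoid)
open import Relation.Unary using (Pred; _∈_)

Point : Set
Point = ℤ × ℤ × ℤ

origin : Point
origin = ℤ.+ 0 , ℤ.+ 0 , ℤ.+ 0

max₃ : ℕ → ℕ → ℕ → ℕ
max₃ a b c = a ⊔ b ⊔ c

N₁₈ : Point → Pred Point 0ℓ
N₁₈ (xr , yr , zr) (xs , ys , zs) =
  let dx = ∣ xr ℤ.- xs ∣
      dy = ∣ yr ℤ.- ys ∣
      dz = ∣ zr ℤ.- zs ∣
  in max₃ dx dy dz ≤ 1 × dx + dy + dz ≤ 2

record Path (q p : Point) (n : ℕ) : Set where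
  field
    points : Vec Point (suc n)
    start  : lookup points zero ≡ q
    finish : lookup points (fromℕ n) ≡ p
    step   : (t : Fin n) → lookup points (suc t) ∈ N₁₈ (lookup points (inject₁ t))

record ShortestPath (q p : Point) : Set where
  field
    len     : ℕ
    path    : Path q p len
    minimal : (m : ℕ) → Path q p m → len ≤ m

  pointSequence : List Point
  pointSequence = toList (Path.points path)

-- Equality compares only the sequences of points, not the proofs
-- of adjacency and minimality.
ShortestPaths : Point → Point → Setoid 0ℓ 0ℓ
ShortestPaths q p =
  On.setoid (setoid (List Point)) (ShortestPath.pointSequence {q} {p})

HasCardinality : Setoid 0ℓ 0ℓ → ℕ → Set
HasCardinality S n = Bijection (setoid (Fin n)) S

D₁₈ : ℕ → ℕ → ℕ → ℕ
D₁₈ i j k = max₃ i j k ⊔ ⌈ i + j + k /2⌉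

denominator : (i j k a b : ℕ) → ℕ
denominator i j k a b =
  a ! * b ! * (k + a) ! * (j + b) ! * (i ∸ j ∸ k ∸ 2 * (a + b)) !

denominator≢0 : ∀ i j k a b → NonZero (denominator i j k a b)
denominator≢0 i j k a b =
  a !≢0 ⋆ b !≢0 ⋆ (k + a) !≢0 ⋆ (j + b) !≢0 ⋆ (i ∸ j ∸ k ∸ 2 * (a + b)) !≢0
  where
  infixl 3 _⋆_
  _⋆_ : ∀ {m n} → NonZero m → NonZero n → NonZero (m * n)
  _⋆_ {m} {n} p q = m*n≢0 m n {{p}} {{q}}

-- Truncated subtraction and floor division are both exact in the range
-- where this is used: j + k ≤ i, which D₁₈ i j k ≡ i implies, and
-- 2 * (a + b) ≤ i ∸ j ∸ k. See denominator∣i! for the division.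
summand : (i j k a b : ℕ) → ℕ
summand i j k a b = (i ! / denominator i j k a b) {{denominator≢0 i j k a b}}

indices : (i j k : ℕ) → List (ℕ × ℕ)
indices i j k =
  filter (λ (a , b) → 2 * (a + b) ≤? i ∸ j ∸ k)
         (cartesianProduct (upTo (suc i)) (upTo (suc i)))

-- The constraint 2 * (a + b) ≤ i ∸ j ∸ k forces a ≤ i and b ≤ i, so
-- restricting the candidates to {0,…,i}² omits no index.
multinomialSum : (i j k : ℕ) → ℕ
multinomialSum i j k = sum (map (λ (a , b) → summand i j k a b) (indices i j k))

m!*n!∣[m+n]! : ∀ m n → m ! * n ! ∣ (m + n) !
m!*n!∣[m+n]! m n =
  subst (λ r → m ! * r ! ∣ (m + n) !) (m+n∸m≡n m n) (k![n∸k]!∣n! (m≤m+n m n))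

denominator∣i! : ∀ i j k a b → j + k ≤ i → 2 * (a + b) ≤ i ∸ j ∸ k →
                 denominator i j k a b ∣ i !
denominator∣i! i j k a b j+k≤i 2[a+b]≤ =
  subst (λ n → denominator i j k a b ∣ n !) total
    (extend (a + b + (k + a) + (j + b)) r
      (extend (a + b + (k + a)) (j + b)
        (extend (a + b) (k + a) (m!*n!∣[m+n]! a b))))
  where
  r = i ∸ j ∸ k ∸ 2 * (a + b)

  extend : ∀ {d} m n → d ∣ m ! → d * n ! ∣ (m + n) !
  extend m n d∣m! = ∣-trans (*-monoˡ-∣ (n !) d∣m!) (m!*n!∣[m+n]! m n)

  regroup : a + b + (k + a) + (j + b) + r ≡ j + k + (2 * (a + b) + r)
  regroup = solve 5 (λ a b j k r →
    a :+ b :+ (k :+ a) :+ (j :+ b) :+ r := j :+ k :+ (con 2 :* (a :+ b) :+ r))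
    refl a b j k r
    where open +-*-Solver

  total : a + b + (k + a) + (j + b) + r ≡ i
  total = trans regroup (trans
    (cong (j + k +_) (trans (m+[n∸m]≡n 2[a+b]≤) (∸-+-assoc i j k)))
    (m+[n∸m]≡n j+k≤i))

{-# OPTIONS --safe #-}

-- A path of length i from the origin to x = i must increase x in every step,
-- which leaves five possible moves, so the shortest paths are the words of
-- length i over these moves whose total displacement is (i, j, k). Fixing the
-- numbers a and b of moves (1,0,-1) and (1,-1,0) fixes the number of each other
-- move as well, so these words split into multinomial classes indexed by (a, b).
-- The multinomial count comes from removing the first letter s of a word with
-- letter counts v: as ∏ v! = v(s) · ∏ (v - s)!, each s contributes
-- v(s) · (n - 1)!, and these add up to n!.

module Submission where

open import Defs
open import Algebra.Bundles using (module AbelianGroup)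
import Algebra.Properties.Group as GroupProperties
open import Data.Fin.Base using (Fin; zero; suc; inject₁; fromℕ)
open import Data.Fin.Patterns using (0F; 1F; 2F; 3F; 4F)
import Data.Fin.Properties as Fin
open import Data.Integer.Base as ℤ using (ℤ; +_; -[1+_]; ∣_∣)
import Data.Integer.Properties as ℤ
import Data.Integer.Tactic.RingSolver as ℤSolver
open import Data.List.Base as List
  using (List; []; _∷_; map; filter; upTo; cartesianProduct; cartesianProductWith;
         allFin; tabulate; concatMap; length)
import Data.List.Properties as List
open import Data.List.Membership.Propositional using (_∈_; find; lose)
open import Data.List.Membership.Propositional.Properties
  using (∈-filter⁺; ∈-filter⁻; ∈-cartesianProductWith⁺; ∈-cartesianProduct⁺;
         ∈-concatMap⁺; ∈-concatMap⁻; ∈-allFin; ∈-upTo⁺; ∈-lookup)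
open import Data.List.Relation.Binary.Disjoint.Propositional using (Disjoint)
open import Data.List.Relation.Unary.All as All using (All; []; _∷_)
import Data.List.Relation.Unary.All.Properties as All
open import Data.List.Relation.Unary.AllPairs as AllPairs using ([]; _∷_)
import Data.List.Relation.Unary.AllPairs.Properties as AllPairs
open import Data.List.Relation.Unary.Any as Any using (here)
open import Data.List.Relation.Unary.Any.Properties using (lookup-index)
open import Data.List.Relation.Unary.Unique.Propositional using (Unique)
open import Data.List.Relation.Unary.Unique.Propositional.Properties
  using (allFin⁺; upTo⁺; filter⁺; cartesianProductWith⁺; cartesianProduct⁺; concat⁺)
open import Data.Nat.Base
open import Data.Nat.DivMod using (m*n/n≡m)
open import Data.Nat.ListAction using (sum)
open import Data.Nat.Properties
open import Data.Nat.Tactic.RingSolver using (solve-∀)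
open import Data.Product.Base using (_×_; _,_; proj₁; proj₂; ∃-syntax)
open import Data.Product.Properties using (≡-dec)
open import Data.Vec.Base as Vec using (Vec; []; _∷_; lookup; updateAt; replicate; toList)
import Data.Vec.Properties as Vec
open import Function.Base using (id; _∘_)
open import Relation.Binary.PropositionalEquality
open import Relation.Nullary using (¬_; contradiction)
open import Relation.Nullary.Decidable using (yes; no; from-yes; _→-dec_)
open import Relation.Unary using (Pred; Decidable)

-- Lists: positions and lengths

lookup-injective : ∀ {a} {A : Set a} {xs : List A} → Unique xs →
                   ∀ s t → List.lookup xs s ≡ List.lookup xs t → s ≡ t
lookup-injective (_ ∷ _)   zero    zero    _  = refl
lookup-injective (x∉ ∷ _)  zero    (suc t) eq = contradiction eq (All.lookup x∉ (∈-lookup t))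
lookup-injective (x∉ ∷ _)  (suc s) zero    eq = contradiction (sym eq) (All.lookup x∉ (∈-lookup s))
lookup-injective (_ ∷ xs!) (suc s) (suc t) eq = cong suc (lookup-injective xs! s t eq)

length-concatMap : ∀ {a b} {A : Set a} {B : Set b} (f : A → List B) xs →
                   length (concatMap f xs) ≡ sum (map (length ∘ f) xs)
length-concatMap f []       = refl
length-concatMap f (x ∷ xs) =
  trans (List.length-++ (f x)) (cong₂ _+_ refl (length-concatMap f xs))

length-filter-map : ∀ {a b p} {A : Set a} {B : Set b} {P : Pred B p} (P? : Decidable P)
                    (f : A → B) xs →
                    length (filter P? (map f xs)) ≡ length (filter (P? ∘ f) xs)
length-filter-map P? f [] = refl
length-filter-map P? f (x ∷ xs) with P? (f x)
... | yes _ = cong suc (length-filter-map P? f xs)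
... | no _  = length-filter-map P? f xs

-- Used with `_∷_` for `f`, where it splits a count of words according to the first letter.
length-filter-cartesianProductWith :
  ∀ {a b c p} {A : Set a} {B : Set b} {C : Set c} {P : Pred C p} (P? : Decidable P)
  (f : A → B → C) xs ys →
  length (filter P? (cartesianProductWith f xs ys)) ≡
  sum (map (λ x → length (filter (P? ∘ f x) ys)) xs)
length-filter-cartesianProductWith P? f []       ys = refl
length-filter-cartesianProductWith P? f (x ∷ xs) ys = begin
  length (filter P? (map (f x) ys List.++ cartesianProductWith f xs ys))
    ≡⟨ cong length (List.filter-++ P? (map (f x) ys) _) ⟩
  length (filter P? (map (f x) ys) List.++ filter P? (cartesianProductWith f xs ys))
    ≡⟨ List.length-++ (filter P? (map (f x) ys)) ⟩
  length (filter P? (map (f x) ys)) + length (filter P? (cartesianProductWith f xs ys))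
    ≡⟨ cong₂ _+_ (length-filter-map P? (f x) ys) (length-filter-cartesianProductWith P? f xs ys) ⟩
  length (filter (P? ∘ f x) ys) + sum (map (λ x → length (filter (P? ∘ f x) ys)) xs) ∎
  where open ≡-Reasoning

-- Words with a prescribed number of occurrences of each letter

words : ∀ m n → List (Vec (Fin m) n)
words m zero    = [] ∷ []
words m (suc n) = cartesianProductWith _∷_ (allFin m) (words m n)

words-complete : ∀ {m n} (w : Vec (Fin m) n) → w ∈ words m n
words-complete []      = here refl
words-complete (s ∷ w) = ∈-cartesianProductWith⁺ _∷_ (∈-allFin s) (words-complete w)

words-unique : ∀ m n → Unique (words m n)
words-unique m zero    = [] ∷ []
words-unique m (suc n) =
  cartesianProductWith⁺ _∷_ Vec.∷-injective (allFin⁺ m) (words-unique m n)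

-- The Parikh vector of a word.
content : ∀ {m n} → Vec (Fin m) n → Vec ℕ m
content []      = replicate _ 0
content (s ∷ w) = updateAt (content w) s suc

content? : ∀ {m n} (v : Vec ℕ m) → Decidable (λ (w : Vec (Fin m) n) → content w ≡ v)
content? v w = Vec.≡-dec _≟_ (content w) v

arrangements : ∀ {m} n → Vec ℕ m → List (Vec (Fin m) n)
arrangements {m} n v = filter (content? v) (words m n)

∏! : ∀ {m} → Vec ℕ m → ℕ
∏! []      = 1
∏! (x ∷ v) = x ! * ∏! v

sum-updateAt-suc : ∀ {m} (v : Vec ℕ m) s → Vec.sum (updateAt v s suc) ≡ suc (Vec.sum v)
sum-updateAt-suc (x ∷ v) zero    = refl
sum-updateAt-suc (x ∷ v) (suc s) = trans (cong₂ _+_ refl (sum-updateAt-suc v s)) (+-suc x _)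

-- The identity ∏ v! = v(s) · ∏ (v - s)!, with `v` here in the role of the smaller vector:
-- incrementing avoids a truncated predecessor.
∏!-updateAt-suc : ∀ {m} (v : Vec ℕ m) s → ∏! (updateAt v s suc) ≡ suc (lookup v s) * ∏! v
∏!-updateAt-suc (x ∷ v) zero    = *-assoc (suc x) (x !) (∏! v)
∏!-updateAt-suc (x ∷ v) (suc s) =
  trans (cong (x ! *_) (∏!-updateAt-suc v s)) (lemma (x !) (lookup v s) (∏! v))
  where
  lemma : ∀ a b c → a * (suc b * c) ≡ suc b * (a * c)
  lemma = solve-∀

updateAt-pred-suc : ∀ {m} (v : Vec ℕ m) s → updateAt (updateAt v s suc) s pred ≡ v
updateAt-pred-suc v s = trans (Vec.updateAt-updateAt s v) (Vec.updateAt-id s v)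

updateAt-suc-injective : ∀ {m} {u v : Vec ℕ m} s →
                         updateAt u s suc ≡ updateAt v s suc → u ≡ v
updateAt-suc-injective s eq =
  trans (sym (updateAt-pred-suc _ s)) (trans (cong (λ u → updateAt u s pred) eq) (updateAt-pred-suc _ s))

sum≡0⇒replicate : ∀ {m} (v : Vec ℕ m) → Vec.sum v ≡ 0 → replicate m 0 ≡ v
sum≡0⇒replicate []         eq = refl
sum≡0⇒replicate (zero ∷ v) eq = cong (0 ∷_) (sum≡0⇒replicate v eq)

∏!-replicate-0 : ∀ m → ∏! (replicate m 0) ≡ 1
∏!-replicate-0 zero    = refl
∏!-replicate-0 (suc m) = trans (+-identityʳ _) (∏!-replicate-0 m)

sum-content : ∀ {m n} (w : Vec (Fin m) n) → Vec.sum (content w) ≡ n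
sum-content {m} []  = sum-replicate m
  where
  sum-replicate : ∀ m → Vec.sum (replicate m 0) ≡ 0
  sum-replicate zero    = refl
  sum-replicate (suc m) = sum-replicate m
sum-content (s ∷ w) = trans (sum-updateAt-suc (content w) s) (cong suc (sum-content w))

-- Adds up the counts by first letter, with `c` the product of factorials and `d` the factorial of
-- the remaining length.
sum-tabulate-* : ∀ {m} (v : Vec ℕ m) (f : Fin m → ℕ) {c d} →
                 (∀ s → f s * c ≡ lookup v s * d) → sum (tabulate f) * c ≡ Vec.sum v * d
sum-tabulate-* []      f         eq = refl
sum-tabulate-* (x ∷ v) f {c} {d} eq = begin
  (f zero + sum (tabulate (f ∘ suc))) * c      ≡⟨ *-distribʳ-+ c (f zero) _ ⟩
  f zero * c + sum (tabulate (f ∘ suc)) * c    ≡⟨ cong₂ _+_ (eq zero) (sum-tabulate-* v (f ∘ suc) (eq ∘ suc)) ⟩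
  x * d + Vec.sum v * d                        ≡⟨ *-distribʳ-+ d x _ ⟨
  (x + Vec.sum v) * d                          ∎
  where open ≡-Reasoning

-- The multinomial coefficient in multiplied-out form, so that the induction on `n` involves no
-- division.
length-arrangements : ∀ {m} n (v : Vec ℕ m) → Vec.sum v ≡ n →
                      length (arrangements n v) * ∏! v ≡ n !
length-arrangements {m} zero v Σv≡0 with refl ← sum≡0⇒replicate v Σv≡0 =
  cong₂ _*_ (cong length (List.filter-accept (content? v) {x = []} {xs = []} refl)) (∏!-replicate-0 m)
length-arrangements {m} (suc n) v Σv≡1+n = begin
  length (arrangements (suc n) v) * ∏! v
    ≡⟨ cong (_* ∏! v) (length-filter-cartesianProductWith (content? v) _∷_ (allFin m) (words m n)) ⟩
  sum (map startingWith (allFin m)) * ∏! v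
    ≡⟨ cong (λ xs → sum xs * ∏! v) (List.map-tabulate id startingWith) ⟩
  sum (tabulate startingWith) * ∏! v
    ≡⟨ sum-tabulate-* v startingWith startingWith-count ⟩
  Vec.sum v * n !
    ≡⟨ cong (_* n !) Σv≡1+n ⟩
  suc n ! ∎
  where
  open ≡-Reasoning

  startingWith : Fin m → ℕ
  startingWith s = length (filter (content? v ∘ (s ∷_)) (words m n))

  startingWith-count : ∀ s → startingWith s * ∏! v ≡ lookup v s * n !
  startingWith-count s with lookup v s in eq
  -- A letter with count 0 in `v` begins no word of content `v`, so both sides are 0.
  ... | zero  = cong (λ ws → length ws * ∏! v)
        (List.filter-none (content? v ∘ (s ∷_)) (All.universal absent (words m n)))
    where
    absent : ∀ w → ¬ content (s ∷ w) ≡ v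
    absent w e with () ←
      trans (sym (Vec.lookup∘updateAt s (content w))) (trans (cong (λ x → lookup x s) e) eq)
  ... | suc c = begin
    startingWith s * ∏! v
      ≡⟨ cong₂ _*_ (cong length startingWith≡) (trans (cong ∏! v≡u⁺) (∏!-updateAt-suc u s)) ⟩
    length (arrangements n u) * (suc (lookup u s) * ∏! u)
      ≡⟨ swap (length (arrangements n u)) (suc (lookup u s)) (∏! u) ⟩
    suc (lookup u s) * (length (arrangements n u) * ∏! u)
      ≡⟨ cong₂ _*_ (trans (cong suc (Vec.lookup∘updateAt s v)) 1+pred≡1+c)
           (length-arrangements n u Σu≡n) ⟩
    suc c * n ! ∎
    where
    -- `pred` loses nothing here: the entry at `s` is `suc c`, so incrementing `u` at `s` restores
    -- `v`.
    u = updateAt v s pred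

    1+pred≡1+c : suc (pred (lookup v s)) ≡ suc c
    1+pred≡1+c = cong (λ x → suc (pred x)) eq

    v≡u⁺ : v ≡ updateAt u s suc
    v≡u⁺ = sym (trans (Vec.updateAt-updateAt s v)
      (Vec.updateAt-id-local s v (trans 1+pred≡1+c (sym eq))))

    Σu≡n : Vec.sum u ≡ n
    Σu≡n = suc-injective
      (trans (sym (sum-updateAt-suc u s)) (trans (cong Vec.sum (sym v≡u⁺)) Σv≡1+n))

    startingWith≡ : filter (content? v ∘ (s ∷_)) (words m n) ≡ arrangements n u
    startingWith≡ = List.filter-≐ (content? v ∘ (s ∷_)) (content? u)
      ( (λ e → updateAt-suc-injective s (trans e v≡u⁺))
      , (λ e → trans (cong (λ x → updateAt x s suc) e) (sym v≡u⁺))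
      ) (words m n)

    swap : ∀ a b c → a * (b * c) ≡ b * (a * c)
    swap = solve-∀

-- Paths whose x-coordinate grows at every step

infixl 6 _⊕_
_⊕_ : Point → Point → Point
(x , y , z) ⊕ (x′ , y′ , z′) = x ℤ.+ x′ , y ℤ.+ y′ , z ℤ.+ z′

point-≡ : ∀ {x x′ y y′ z z′ : ℤ} → x ≡ x′ → y ≡ y′ → z ≡ z′ →
          (x , y , z) ≡ (x′ , y′ , z′)
point-≡ refl refl refl = refl

⊕-assoc : ∀ p q r → (p ⊕ q) ⊕ r ≡ p ⊕ (q ⊕ r)
⊕-assoc (x , y , z) (x′ , y′ , z′) (x″ , y″ , z″) =
  point-≡ (ℤ.+-assoc x x′ x″) (ℤ.+-assoc y y′ y″) (ℤ.+-assoc z z′ z″)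

⊕-comm : ∀ p q → p ⊕ q ≡ q ⊕ p
⊕-comm (x , y , z) (x′ , y′ , z′) =
  point-≡ (ℤ.+-comm x x′) (ℤ.+-comm y y′) (ℤ.+-comm z z′)

⊕-identityˡ : ∀ p → origin ⊕ p ≡ p
⊕-identityˡ (x , y , z) =
  point-≡ (ℤ.+-identityˡ x) (ℤ.+-identityˡ y) (ℤ.+-identityˡ z)

⊕-cancelˡ : ∀ p {q r} → p ⊕ q ≡ p ⊕ r → q ≡ r
⊕-cancelˡ (x , y , z) eq = point-≡
  (∙-cancelˡ x _ _ (cong proj₁ eq))
  (∙-cancelˡ y _ _ (cong (proj₁ ∘ proj₂) eq))
  (∙-cancelˡ z _ _ (cong (proj₂ ∘ proj₂) eq))
  where open GroupProperties (AbelianGroup.group ℤ.+-0-abelianGroup) using (∙-cancelˡ)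

-- The letters are ordered as the factors of the denominator: right-away
-- (a steps), right-bottom (b), their mirror images (k + a and j + b), and
-- right.
direction : Fin 5 → ℤ × ℤ
direction 0F = + 0 , -[1+ 0 ]
direction 1F = -[1+ 0 ] , + 0
direction 2F = + 0 , + 1
direction 3F = + 1 , + 0
direction 4F = + 0 , + 0

move : Fin 5 → Point
move s = + 1 , direction s

move-injective : ∀ s t → move s ≡ move t → s ≡ t
move-injective = from-yes (Fin.all? λ s → Fin.all? λ t →
  ≡-dec ℤ._≟_ (≡-dec ℤ._≟_ ℤ._≟_) (move s) (move t) →-dec (s Fin.≟ t))

i-[i+j]≡-j : ∀ i j → i ℤ.- (i ℤ.+ j) ≡ ℤ.- j
i-[i+j]≡-j = ℤSolver.solve-∀

i+-[i-j]≡j : ∀ i j → i ℤ.+ (ℤ.- (i ℤ.- j)) ≡ j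
i+-[i-j]≡j = ℤSolver.solve-∀

move-adjacent : ∀ p s → N₁₈ p (p ⊕ move s)
move-adjacent (x , y , z) s
  -- `N₁₈` takes old minus new coordinates, so the differences become the negated entries of the
  -- move, which are closed terms once `s` is known.
  rewrite i-[i+j]≡-j x (+ 1)
        | i-[i+j]≡-j y (proj₁ (direction s))
        | i-[i+j]≡-j z (proj₂ (direction s))
  with s
... | 0F = s≤s z≤n , s≤s (s≤s z≤n)
... | 1F = s≤s z≤n , s≤s (s≤s z≤n)
... | 2F = s≤s z≤n , s≤s (s≤s z≤n)
... | 3F = s≤s z≤n , s≤s (s≤s z≤n)
... | 4F = s≤s z≤n , s≤s z≤n

-- The unit ball of the 1-norm in the integer plane has exactly five points, one per letter. The
-- signs are reversed because `e` and `f` will be old minus new coordinates.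
direction-surjective : ∀ e f → ∣ e ∣ + ∣ f ∣ ≤ 1 → ∃[ s ] direction s ≡ (ℤ.- e , ℤ.- f)
direction-surjective (+ 0)             (+ 0)             _ = 4F , refl
direction-surjective (+ 0)             (+ 1)             _ = 0F , refl
direction-surjective (+ 0)             -[1+ 0 ]          _ = 2F , refl
direction-surjective (+ 1)             (+ 0)             _ = 1F , refl
direction-surjective -[1+ 0 ]          (+ 0)             _ = 3F , refl
direction-surjective (+ 0)             (+ suc (suc _))   (s≤s ())
direction-surjective (+ 0)             -[1+ suc _ ]      (s≤s ())
direction-surjective (+ 1)             (+ suc _)         (s≤s ())
direction-surjective (+ 1)             -[1+ _ ]          (s≤s ())
direction-surjective (+ suc (suc _))   _                 (s≤s ())
direction-surjective -[1+ 0 ]          (+ suc _)         (s≤s ())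
direction-surjective -[1+ 0 ]          -[1+ _ ]          (s≤s ())
direction-surjective -[1+ suc _ ]      _                 (s≤s ())

-- Raising x by 1 uses one unit of the bound 2 on the sum of differences, which leaves at most one
-- unit for y and z together.
adjacent⇒move : ∀ p q → N₁₈ p q → proj₁ q ≡ proj₁ p ℤ.+ + 1 → ∃[ s ] q ≡ p ⊕ move s
adjacent⇒move (x , y , z) (_ , y′ , z′) (_ , d≤2) refl
  rewrite i-[i+j]≡-j x (+ 1)
  with s , eq ← direction-surjective (y ℤ.- y′) (z ℤ.- z′) (s≤s⁻¹ d≤2) =
  s , point-≡ refl
    (sym (trans (cong (λ d → y ℤ.+ proj₁ d) eq) (i+-[i-j]≡j y y′)))
    (sym (trans (cong (λ d → z ℤ.+ proj₂ d) eq) (i+-[i-j]≡j z z′)))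

-i≤∣i∣ : ∀ i → ℤ.- i ℤ.≤ + ∣ i ∣
-i≤∣i∣ (+ zero)  = ℤ.≤-refl
-i≤∣i∣ (+ suc n) = ℤ.-≤+
-i≤∣i∣ -[1+ n ]  = ℤ.≤-refl

adjacent⇒x≤1+x : ∀ p q → N₁₈ p q → proj₁ q ℤ.≤ proj₁ p ℤ.+ + 1
adjacent⇒x≤1+x (x , y , z) (x′ , y′ , z′) (max≤1 , _) =
  subst (ℤ._≤ x ℤ.+ + 1) (i+-[i-j]≡j x x′)
    (ℤ.+-monoʳ-≤ x (ℤ.≤-trans (-i≤∣i∣ (x ℤ.- x′)) (ℤ.+≤+ dx≤1)))
  where
  dx≤1 : ∣ x ℤ.- x′ ∣ ≤ 1
  dx≤1 = m⊔n≤o⇒m≤o _ ∣ y ℤ.- y′ ∣ (m⊔n≤o⇒m≤o _ ∣ z ℤ.- z′ ∣ max≤1)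

-- Walks along words

Adjacent : ∀ {n} → Vec Point (suc n) → Set
Adjacent {n} ps = ∀ (t : Fin n) → N₁₈ (lookup ps (inject₁ t)) (lookup ps (suc t))

final : ∀ {n} → Vec Point (suc n) → Point
final {n} ps = lookup ps (fromℕ n)

-- No step raises x by more than 1. This bounds the length of every path from below, and its case of
-- equality characterises the shortest paths.
x-growth : ∀ {n} p (ps : Vec Point n) → Adjacent (p ∷ ps) →
           proj₁ (final (p ∷ ps)) ℤ.≤ proj₁ p ℤ.+ + n
x-growth p [] _ = ℤ.≤-reflexive (sym (ℤ.+-identityʳ (proj₁ p)))
x-growth {suc n} p (q ∷ ps) adj = begin
  proj₁ (final (q ∷ ps))       ≤⟨ x-growth q ps (adj ∘ suc) ⟩
  proj₁ q ℤ.+ + n              ≤⟨ ℤ.+-monoˡ-≤ (+ n) (adjacent⇒x≤1+x p q (adj zero)) ⟩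
  proj₁ p ℤ.+ + 1 ℤ.+ + n      ≡⟨ ℤ.+-assoc (proj₁ p) (+ 1) (+ n) ⟩
  proj₁ p ℤ.+ + suc n          ∎
  where open ℤ.≤-Reasoning

walk : ∀ {n} → Point → Vec (Fin 5) n → Vec Point (suc n)
walk p []      = p ∷ []
walk p (s ∷ w) = p ∷ walk (p ⊕ move s) w

walk-start : ∀ {n} p (w : Vec (Fin 5) n) → lookup (walk p w) zero ≡ p
walk-start p []      = refl
walk-start p (s ∷ w) = refl

walk-adjacent : ∀ {n} p (w : Vec (Fin 5) n) → Adjacent (walk p w)
walk-adjacent p (s ∷ w) zero =
  subst (N₁₈ p) (sym (walk-start (p ⊕ move s) w)) (move-adjacent p s)
walk-adjacent p (s ∷ w) (suc t) = walk-adjacent (p ⊕ move s) w t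

walk-injective : ∀ {n} p (w w′ : Vec (Fin 5) n) → walk p w ≡ walk p w′ → w ≡ w′
walk-injective p []      []        _  = refl
walk-injective p (s ∷ w) (s′ ∷ w′) eq
  with walks≡ ← Vec.∷-injectiveʳ eq
  -- The remaining walks start at `p ⊕ move s` and `p ⊕ move s′`; cancelling `p` identifies the two
  -- letters.
  with refl ← move-injective s s′ (⊕-cancelˡ p (trans (sym (walk-start _ w))
         (trans (cong (λ ps → lookup ps zero) walks≡) (walk-start _ w′))))
  = cong (s ∷_) (walk-injective (p ⊕ move s) w w′ walks≡)

-- A path that reaches the bound of x-growth attains it at every step.
walk-surjective : ∀ {n} p (ps : Vec Point n) → Adjacent (p ∷ ps) →
                  proj₁ (final (p ∷ ps)) ≡ proj₁ p ℤ.+ + n →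
                  ∃[ w ] p ∷ ps ≡ walk p w
walk-surjective p [] _ _ = [] , refl
walk-surjective {suc n} p (q ∷ ps) adj eq =
  let s , q≡ = adjacent⇒move p q (adj zero) x-q
      w , ps≡ = walk-surjective q ps (adj ∘ suc)
        (trans eq (trans (sym (ℤ.+-assoc (proj₁ p) (+ 1) (+ n))) (cong (λ x → x ℤ.+ + n) (sym x-q))))
  in s ∷ w , cong (p ∷_) (trans ps≡ (cong (λ r → walk r w) q≡))
  where
  x-q : proj₁ q ≡ proj₁ p ℤ.+ + 1
  x-q = ℤ.≤-antisym (adjacent⇒x≤1+x p q (adj zero)) (ℤ.≮⇒≥ λ x-q< → ℤ.<-irrefl eq (begin-strict
    proj₁ (final (q ∷ ps))    ≤⟨ x-growth q ps (adj ∘ suc) ⟩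
    proj₁ q ℤ.+ + n           <⟨ ℤ.+-monoˡ-< (+ n) x-q< ⟩
    proj₁ p ℤ.+ + 1 ℤ.+ + n   ≡⟨ ℤ.+-assoc (proj₁ p) (+ 1) (+ n) ⟩
    proj₁ p ℤ.+ + suc n       ∎))
    where open ℤ.≤-Reasoning

-- The sum of all moves counted by `v`: every letter adds 1 to x, letters 3 and 1 are opposite in y,
-- letters 2 and 0 are opposite in z.
displacement : Vec ℕ 5 → Point
displacement v =
  + Vec.sum v , + lookup v 3F ℤ.- + lookup v 1F , + lookup v 2F ℤ.- + lookup v 0F

displacement-updateAt-suc : ∀ v s → displacement (updateAt v s suc) ≡ displacement v ⊕ move s
displacement-updateAt-suc v@(a ∷ b ∷ c ∷ d ∷ e ∷ []) s =
  point-≡ (cong +_ (trans (sum-updateAt-suc v s) (+-comm 1 _))) (y s) (z s)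
  where
  grow : ∀ m n → + suc m ℤ.- + n ≡ + m ℤ.- + n ℤ.+ + 1
  grow m n = lemma (+ m) (+ n)
    where
    lemma : ∀ i j → + 1 ℤ.+ i ℤ.- j ≡ i ℤ.- j ℤ.+ + 1
    lemma = ℤSolver.solve-∀

  shrink : ∀ m n → + m ℤ.- + suc n ≡ + m ℤ.- + n ℤ.+ -[1+ 0 ]
  shrink m n = lemma (+ m) (+ n)
    where
    lemma : ∀ i j → i ℤ.- (+ 1 ℤ.+ j) ≡ i ℤ.- j ℤ.+ -[1+ 0 ]
    lemma = ℤSolver.solve-∀

  stay : ∀ i → i ≡ i ℤ.+ + 0
  stay i = sym (ℤ.+-identityʳ i)

  y : ∀ s → proj₁ (proj₂ (displacement (updateAt v s suc))) ≡ + d ℤ.- + b ℤ.+ proj₁ (direction s)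
  y 0F = stay _
  y 1F = shrink d b
  y 2F = stay _
  y 3F = grow d b
  y 4F = stay _

  z : ∀ s → proj₂ (proj₂ (displacement (updateAt v s suc))) ≡ + c ℤ.- + a ℤ.+ proj₂ (direction s)
  z 0F = shrink c a
  z 1F = stay _
  z 2F = grow c a
  z 3F = stay _
  z 4F = stay _

-- The endpoint depends on the word only through its content, which turns the count of paths into a
-- count of words by content.
walk-final : ∀ {n} p (w : Vec (Fin 5) n) → final (walk p w) ≡ p ⊕ displacement (content w)
walk-final p []      = sym (trans (⊕-comm p origin) (⊕-identityˡ p))
walk-final p (s ∷ w) = begin
  final (walk (p ⊕ move s) w)               ≡⟨ walk-final (p ⊕ move s) w ⟩
  p ⊕ move s ⊕ displacement (content w)     ≡⟨ ⊕-assoc p (move s) (displacement (content w)) ⟩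
  p ⊕ (move s ⊕ displacement (content w))   ≡⟨ cong (p ⊕_) (⊕-comm (move s) (displacement (content w))) ⟩
  p ⊕ (displacement (content w) ⊕ move s)   ≡⟨ cong (p ⊕_) (displacement-updateAt-suc (content w) s) ⟨
  p ⊕ displacement (content (s ∷ w))        ∎
  where open ≡-Reasoning

-- Counting the shortest paths

-- No word is constructed: an empty list of arrangements would make the nonzero number `n !` equal
-- to 0.
content-surjective : ∀ {m} n (v : Vec ℕ m) → Vec.sum v ≡ n → ∃[ w ] content {n = n} w ≡ v
content-surjective n v Σv≡n with arrangements n v in eq
... | w ∷ _ = w , proj₂ (∈-filter⁻ (content? v) {xs = words _ n} (subst (w ∈_) (sym eq) (here refl)))
... | []    = contradiction
  (trans (sym (length-arrangements n v Σv≡n)) (cong (λ ws → length ws * ∏! v) eq))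
  (≢-nonZero⁻¹ (n !) {{n !≢0}})

-- The two halves of i + j + k, rounded down and up, are both at most i; adding them and cancelling
-- one i gives the bound.
D₁₈≤i⇒j+k≤i : ∀ i j k → D₁₈ i j k ≤ i → j + k ≤ i
D₁₈≤i⇒j+k≤i i j k D≤i = +-cancelˡ-≤ i (j + k) i (begin
  i + (j + k)                  ≡⟨ +-assoc i j k ⟨
  n                            ≡⟨ ⌊n/2⌋+⌈n/2⌉≡n n ⟨
  ⌊ n /2⌋ + ⌈ n /2⌉            ≤⟨ +-mono-≤ (≤-trans (⌊n/2⌋≤⌈n/2⌉ n) ⌈n/2⌉≤i) ⌈n/2⌉≤i ⟩
  i + i                        ∎)
  where
  open ≤-Reasoning
  n = i + j + k

  ⌈n/2⌉≤i : ⌈ n /2⌉ ≤ i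
  ⌈n/2⌉≤i = m⊔n≤o⇒n≤o (max₃ i j k) ⌈ n /2⌉ D≤i

+m-+n≡+o⇒m≡o+n : ∀ {m n o} → + m ℤ.- + n ≡ + o → m ≡ o + n
+m-+n≡+o⇒m≡o+n {m} {n} eq =
  ℤ.+-injective (trans (lemma (+ m) (+ n)) (cong (λ x → x ℤ.+ + n) eq))
  where
  lemma : ∀ x y → x ≡ x ℤ.- y ℤ.+ y
  lemma = ℤSolver.solve-∀

+[m+n]-+n≡+m : ∀ m n → + (m + n) ℤ.- + n ≡ + m
+[m+n]-+n≡+m m n = lemma (+ m) (+ n)
  where
  lemma : ∀ x y → x ℤ.+ y ℤ.- y ≡ x
  lemma = ℤSolver.solve-∀

-- Letter counts with displacement (i, j, k)

module _ (i j k : ℕ) (j+k≤i : j + k ≤ i) where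

  -- The general solution of `displacement v ≡ target`: y and z fix the differences between opposite
  -- letters, x fixes the number of straight moves, and a and b stay free.
  stepCounts : ℕ × ℕ → Vec ℕ 5
  stepCounts (a , b) = a ∷ b ∷ k + a ∷ j + b ∷ i ∸ j ∸ k ∸ 2 * (a + b) ∷ []

  sum-stepCounts : ∀ a b → 2 * (a + b) ≤ i ∸ j ∸ k → Vec.sum (stepCounts (a , b)) ≡ i
  sum-stepCounts a b 2[a+b]≤ = begin
    Vec.sum (stepCounts (a , b))                           ≡⟨ regroup a b j k (i ∸ j ∸ k ∸ 2 * (a + b)) ⟩
    j + k + (2 * (a + b) + (i ∸ j ∸ k ∸ 2 * (a + b)))      ≡⟨ cong (λ n → j + k + n) (m+[n∸m]≡n 2[a+b]≤) ⟩
    j + k + (i ∸ j ∸ k)                                    ≡⟨ cong (λ n → j + k + n) (∸-+-assoc i j k) ⟩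
    j + k + (i ∸ (j + k))                                  ≡⟨ m+[n∸m]≡n j+k≤i ⟩
    i                                                      ∎
    where
    open ≡-Reasoning
    regroup : ∀ a b j k r → a + (b + (k + a + (j + b + (r + 0)))) ≡ j + k + (2 * (a + b) + r)
    regroup = solve-∀

  admissible? : Decidable (λ ((a , b) : ℕ × ℕ) → 2 * (a + b) ≤ i ∸ j ∸ k)
  admissible? (a , b) = 2 * (a + b) ≤? i ∸ j ∸ k

  -- The finite grid of candidates loses no pair, since a + b ≤ 2(a + b) ≤ i.
  ∈-indices⁺ : ∀ {a b} → 2 * (a + b) ≤ i ∸ j ∸ k → (a , b) ∈ indices i j k
  ∈-indices⁺ {a} {b} 2[a+b]≤ = ∈-filter⁺ admissible?
    (∈-cartesianProduct⁺ (∈-upTo⁺ (s≤s (≤-trans (m≤m+n a b) a+b≤i)))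
                         (∈-upTo⁺ (s≤s (≤-trans (m≤n+m b a) a+b≤i))))
    2[a+b]≤
    where
    a+b≤i : a + b ≤ i
    a+b≤i = ≤-trans (m≤m+n (a + b) _)
      (≤-trans 2[a+b]≤ (≤-trans (m∸n≤m (i ∸ j) k) (m∸n≤m i j)))

  ∈-indices⁻ : ∀ {a b} → (a , b) ∈ indices i j k → 2 * (a + b) ≤ i ∸ j ∸ k
  ∈-indices⁻ ab∈ =
    proj₂ (∈-filter⁻ admissible? {xs = cartesianProduct (upTo (suc i)) (upTo (suc i))} ab∈)

  indices-unique : Unique (indices i j k)
  indices-unique = filter⁺ admissible? (cartesianProduct⁺ (upTo⁺ (suc i)) (upTo⁺ (suc i)))

  target : Point
  target = + i , + j , + k

  displacement-stepCounts : ∀ {ab} → ab ∈ indices i j k → displacement (stepCounts ab) ≡ target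
  displacement-stepCounts {a , b} ab∈ = point-≡
    (cong +_ (sum-stepCounts a b (∈-indices⁻ ab∈))) (+[m+n]-+n≡+m j b) (+[m+n]-+n≡+m k a)

  -- The y and z coordinates determine `d` and `c` from `b` and `a`; the x coordinate then
  -- determines `e`.
  displacement≡target⇒stepCounts : ∀ v → displacement v ≡ target →
                                   ∃[ ab ] ab ∈ indices i j k × v ≡ stepCounts ab
  displacement≡target⇒stepCounts (a ∷ b ∷ c ∷ d ∷ e ∷ []) eq
    with refl ← +m-+n≡+o⇒m≡o+n {d} {b} (cong (proj₁ ∘ proj₂) eq)
    with refl ← +m-+n≡+o⇒m≡o+n {c} {a} (cong (proj₂ ∘ proj₂) eq) =
    (a , b) , ∈-indices⁺ (≤-trans (m≤m+n _ e) (≤-reflexive (sym rest)))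
    , cong (λ e → a ∷ b ∷ k + a ∷ j + b ∷ e ∷ [])
        (trans (sym (m+n∸m≡n (2 * (a + b)) e)) (cong (λ n → n ∸ 2 * (a + b)) (sym rest)))
    where
    regroup : ∀ a b j k e → a + (b + (k + a + (j + b + (e + 0)))) ≡ j + k + (2 * (a + b) + e)
    regroup = solve-∀

    -- Taking j + k away from the total number of letters gives both the admissibility of (a, b) and
    -- the value of `e`.
    rest : i ∸ j ∸ k ≡ 2 * (a + b) + e
    rest = trans (∸-+-assoc i j k) (trans
      (cong (_∸ (j + k)) (trans (sym (ℤ.+-injective (cong proj₁ eq))) (regroup a b j k e)))
      (m+n∸m≡n (j + k) (2 * (a + b) + e)))

  -- Words ending at the target and their number

  arrangementsOf : ℕ × ℕ → List (Vec (Fin 5) i)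
  arrangementsOf ab = arrangements i (stepCounts ab)

  shortestWords : List (Vec (Fin 5) i)
  shortestWords = concatMap arrangementsOf (indices i j k)

  ∈-arrangementsOf⁻ : ∀ {ab w} → w ∈ arrangementsOf ab → content w ≡ stepCounts ab
  ∈-arrangementsOf⁻ {ab} w∈ = proj₂ (∈-filter⁻ (content? (stepCounts ab)) {xs = words 5 i} w∈)

  ∈-shortestWords⁺ : ∀ {w} → final (walk origin w) ≡ target → w ∈ shortestWords
  ∈-shortestWords⁺ {w} eq
    with ab , ab∈ , w≡ ← displacement≡target⇒stepCounts (content w)
           (trans (sym (trans (walk-final origin w) (⊕-identityˡ _))) eq) =
    ∈-concatMap⁺ arrangementsOf
      (lose ab∈ (∈-filter⁺ (content? (stepCounts ab)) (words-complete w) w≡))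

  ∈-shortestWords⁻ : ∀ {w} → w ∈ shortestWords → final (walk origin w) ≡ target
  ∈-shortestWords⁻ {w} w∈
    with ab , ab∈ , w∈ab ← find (∈-concatMap⁻ arrangementsOf {xs = indices i j k} w∈) =
    trans (walk-final origin w) (trans (⊕-identityˡ _)
      (trans (cong displacement (∈-arrangementsOf⁻ w∈ab)) (displacement-stepCounts ab∈)))

  -- Classes for different pairs are disjoint because the content of a word shows a and b as its
  -- first two entries.
  shortestWords-unique : Unique shortestWords
  shortestWords-unique = concat⁺
    (All.map⁺ (All.universal (λ ab → filter⁺ (content? (stepCounts ab)) (words-unique 5 i)) (indices i j k)))
    (AllPairs.map⁺ (AllPairs.map arrangements-disjoint indices-unique))
    where
    stepCounts-injective : ∀ {ab ab′} → stepCounts ab ≡ stepCounts ab′ → ab ≡ ab′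
    stepCounts-injective eq =
      cong₂ _,_ (cong (λ v → lookup v 0F) eq) (cong (λ v → lookup v 1F) eq)

    arrangements-disjoint : ∀ {ab ab′} → ab ≢ ab′ → Disjoint (arrangementsOf ab) (arrangementsOf ab′)
    arrangements-disjoint ab≢ (w∈ , w∈′) = ab≢ (stepCounts-injective
      (trans (sym (∈-arrangementsOf⁻ w∈)) (∈-arrangementsOf⁻ w∈′)))

  -- `length-arrangements` exhibits `i !` as a multiple of the denominator, so the floor division in
  -- `summand` is exact.
  length-arrangementsOf : ∀ {a b} → (a , b) ∈ indices i j k →
                          length (arrangementsOf (a , b)) ≡ summand i j k a b
  length-arrangementsOf {a} {b} ab∈ = sym (begin
    i ! / d      ≡⟨ cong (λ n → n / d) i!≡ ⟩
    ℓ * d / d    ≡⟨ m*n/n≡m ℓ d ⟩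
    ℓ            ∎)
    where
    open ≡-Reasoning
    ℓ = length (arrangementsOf (a , b))
    d = denominator i j k a b

    instance
      d≢0 : NonZero d
      d≢0 = denominator≢0 i j k a b

    -- `∏!` nests to the right and ends in a factor 1, whereas `denominator` nests to the left.
    assoc : ∀ p q r s t → p * (q * (r * (s * (t * 1)))) ≡ p * q * r * s * t
    assoc = solve-∀

    i!≡ : i ! ≡ ℓ * d
    i!≡ = trans
      (sym (length-arrangements i (stepCounts (a , b)) (sum-stepCounts a b (∈-indices⁻ ab∈))))
      (cong (ℓ *_) (assoc (a !) (b !) ((k + a) !) ((j + b) !) _))

  length-shortestWords : length shortestWords ≡ multinomialSum i j k
  length-shortestWords = trans (length-concatMap arrangementsOf (indices i j k))
    (cong sum (List.map-cong-local (All.tabulate length-arrangementsOf)))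

  -- Bijection between words and shortest paths

  path-length≥i : ∀ m → Path origin target m → i ≤ m
  path-length≥i m record { points = _ ∷ ps ; start = refl ; finish = finish ; step = adj } =
    ℤ.drop‿+≤+ (begin
      + i                          ≡⟨ cong proj₁ finish ⟨
      proj₁ (final (origin ∷ ps))  ≤⟨ x-growth origin ps adj ⟩
      + m                          ∎)
    where open ℤ.≤-Reasoning

  wordPath : ∀ {w} → w ∈ shortestWords → Path origin target i
  wordPath {w} w∈ = record
    { points = walk origin w
    ; start  = walk-start origin w
    ; finish = ∈-shortestWords⁻ w∈
    ; step   = walk-adjacent origin w
    }

  wordShortestPath : ∀ {w} → w ∈ shortestWords → ShortestPath origin target
  wordShortestPath w∈ = record { len = i ; path = wordPath w∈ ; minimal = path-length≥i }

  -- The length is a variable with an equation because the `len` of a shortest path equals `i` only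
  -- propositionally. Comparing lists keeps the length out of the types.
  path⇒word : ∀ {n} → n ≡ i → (P : Path origin target n) →
              ∃[ w ] w ∈ shortestWords × toList (Path.points P) ≡ toList (walk origin w)
  path⇒word refl record { points = _ ∷ ps ; start = refl ; finish = finish ; step = adj } =
    let w , ps≡ = walk-surjective origin ps adj (cong proj₁ finish)
    in w , ∈-shortestWords⁺ (trans (cong final (sym ps≡)) finish) , cong toList ps≡

  -- Without a path that attains the bound, minimality would not force `len` down to `i`.
  somePath : Path origin target i
  somePath =
    -- The pair (0, 0), with no backward move in y or z, is always admissible.
    let w , w≡ = content-surjective i (stepCounts (0 , 0)) (sum-stepCounts 0 0 z≤n)
    in wordPath (∈-shortestWords⁺ {w} (trans (walk-final origin w) (trans (⊕-identityˡ _)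
         (trans (cong displacement w≡) (displacement-stepCounts {0 , 0} (∈-indices⁺ z≤n))))))

  shortestPath⇒word : (P : ShortestPath origin target) →
    ∃[ w ] w ∈ shortestWords × ShortestPath.pointSequence P ≡ toList (walk origin w)
  shortestPath⇒word P = path⇒word (≤-antisym (minimal i somePath) (path-length≥i len path)) path
    where open ShortestPath P

  shortestPaths-cardinality : HasCardinality (ShortestPaths origin target) (length shortestWords)
  shortestPaths-cardinality = record
    { to        = to
    ; cong      = λ { refl → refl }
    ; bijective = injective , surjective
    }
    where
    to : Fin (length shortestWords) → ShortestPath origin target
    to t = wordShortestPath (∈-lookup {xs = shortestWords} t)

    injective : ∀ {s t} → ShortestPath.pointSequence (to s) ≡ ShortestPath.pointSequence (to t) → s ≡ t
    injective {s} {t} eq = lookup-injective shortestWords-unique s t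
      -- `Vec.toList-injective` yields equality up to a `cast`, which is the identity as both
      -- vectors have length `suc i`.
      (walk-injective origin _ _ (trans (sym (Vec.cast-is-id refl _)) (Vec.toList-injective refl _ _ eq)))

    surjective : ∀ P → ∃[ s ] (∀ {t} → t ≡ s →
                   ShortestPath.pointSequence (to t) ≡ ShortestPath.pointSequence P)
    surjective P =
      let w , w∈ , eq = shortestPath⇒word P
      in Any.index w∈ , λ { refl → sym (trans eq (cong (toList ∘ walk origin) (lookup-index w∈))) }

theorem4p1 : (i j k : ℕ) → D₁₈ i j k ≡ max₃ i j k → max₃ i j k ≡ i →
    HasCardinality (ShortestPaths origin (+ i , + j , + k)) (multinomialSum i j k)
theorem4p1 i j k D≡max max≡i =
  subst (HasCardinality _) (length-shortestWords i j k j+k≤i) (shortestPaths-cardinality i j k j+k≤i)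
  where
  j+k≤i : j + k ≤ i
  j+k≤i = D₁₈≤i⇒j+k≤i i j k (≤-reflexive (trans D≡max max≡i))
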